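{- Let $s>t\ge1$ and $r\ge2$ be integers, and set $$\ell=\left\lceil \frac{r}{\left\lfloor \frac{2s-t-1}{s-t+1}\right\rfloor}\right\rceil .$$ Then $$L_{(s,t)}(n,r)\le (s-1)\binom{n}{\ell}+s-1.$$
   Context: An $r$-uniform hypergraph ($r$-graph) is a family (without repeated members) of $r$-element subsets, called edges, of a finite vertex set. For integers $s\ge t\ge1$, an $r$-graph is called locally $(s,t)$-thin if, among any $s$ distinct edges, at least $t$ of them contain a vertex that belongs to none of the other $s-1$ edges. $L_{(s,t)}(n,r)$ denotes the maximum number of edges in a locally $(s,t)$-thin $r$-graph on $n$ vertices. -}

module Defs where

open import Data.Bool using (Bool)
open import Data.Fin using (Fin; funToFin)
open import Data.Fin.Properties
  using (any?; all?; 2↔Bool; finToFun-funToFin; injective⇒≤)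
  renaming (_≟_ to _≟ᶠ_)
open import Data.Fin.Subset using (Subset; ∣_∣; _∈_; _∉_; _⊆_)
open import Data.Fin.Subset.Properties using (_∈?_; _⊆?_; anySubset?; ∣p∣≤n)
open import Data.Nat
open import Data.Nat.DivMod using (_/_; m≥n⇒m/n>0)
open import Data.Nat.Properties
open import Data.Product using (∃; ∃-syntax; _×_; _,_; proj₁; proj₂)
open import Data.Vec using (Vec; []; _∷_; lookup)
open import Data.Vec.Properties using (tabulate∘lookup; tabulate-cong; ≡-dec)
open import Data.Vec.Relation.Unary.All using (All; [])
import Data.Vec.Relation.Unary.All as All
import Data.Vec.Relation.Unary.AllPairs as AllPairs
open import Data.Vec.Relation.Unary.Unique.Propositional using (Unique; [])
open import Data.Vec.Relation.Unary.Unique.Propositional.Properties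
  using (lookup-injective)
open import Function using (Inverse; _∘_)
open import Level using (Level)
open import Relation.Binary.PropositionalEquality
open import Relation.Nullary
open import Relation.Nullary.Decidable using (map′; ¬?; _×-dec_; _→-dec_)
open import Relation.Unary using (Pred; Decidable)
import Data.Bool.Properties as Bool

private variable
  a : Level
  m n : ℕ

-- The vertex set is Fin n.  A family of m edges is a vector of subsets; the
-- order of the vector is immaterial to everything below.
record IsRGraph (r : ℕ) (E : Vec (Subset n) m) : Set where
  field
    uniform  : All (λ e → ∣ e ∣ ≡ r) E
    distinct : Unique E

-- S and T below are sets of indices into E.  As E is without repetition, a set
-- of s indices is the same thing as a set of s distinct edges.

HasOwnVertex : Vec (Subset n) m → Subset m → Fin m → Set
HasOwnVertex E S i =
  ∃[ v ] v ∈ lookup E i × (∀ j → j ∈ S → j ≢ i → v ∉ lookup E j)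

AtLeast : ℕ → Subset m → (Fin m → Set) → Set
AtLeast t S P = ∃[ T ] T ⊆ S × t ≤ ∣ T ∣ × (∀ i → i ∈ T → P i)

LocallyThin : ℕ → ℕ → Vec (Subset n) m → Set
LocallyThin s t E = ∀ S → ∣ S ∣ ≡ s → AtLeast t S (HasOwnVertex E S)

ThinRGraph : (s t n r m : ℕ) → Set
ThinRGraph s t n r m =
  ∃[ E ] IsRGraph {n} {m} r E × LocallyThin s t E

-- Everything is finite, so the maximum can be found by exhaustive search.

private
  hasOwnVertex? : (E : Vec (Subset n) m) (S : Subset m) →
                  Decidable (HasOwnVertex E S)
  hasOwnVertex? E S i = any? λ v → v ∈? lookup E i ×-dec
    all? λ j → j ∈? S →-dec (¬? (j ≟ᶠ i) →-dec ¬? (v ∈? lookup E j))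

  atLeast? : ∀ t (S : Subset m) {P : Fin m → Set} → Decidable P →
             Dec (AtLeast t S P)
  atLeast? t S P? = anySubset? λ T →
    T ⊆? S ×-dec t ≤? ∣ T ∣ ×-dec all? λ i → i ∈? T →-dec P? i

  allSubset? : {P : Pred (Subset n) a} → Decidable P → Dec (∀ S → P S)
  allSubset? P? with anySubset? (¬? ∘ P?)
  ... | yes (S , ¬p) = no λ p → ¬p (p S)
  ... | no ¬∃        = yes λ S → decidable-stable (P? S) λ ¬p → ¬∃ (S , ¬p)

  anyVec? : {P : Pred (Vec (Subset n) m) a} → Decidable P → Dec (∃ P)
  anyVec? {m = zero}  P? = map′ ([] ,_) (λ { ([] , p) → p }) (P? [])
  anyVec? {m = suc m} P? = map′
    (λ (e , E , p) → e ∷ E , p) (λ { (e ∷ E , p) → e , E , p })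
    (anySubset? λ e → anyVec? λ E → P? (e ∷ E))

  isRGraph? : ∀ r (E : Vec (Subset n) m) → Dec (IsRGraph r E)
  isRGraph? r E = map′
    (λ (u , d) → record { uniform = u ; distinct = d })
    (λ G → IsRGraph.uniform G , IsRGraph.distinct G)
    (All.all? (λ e → ∣ e ∣ ≟ r) E ×-dec
     AllPairs.allPairs? (λ x y → ¬? (≡-dec Bool._≟_ x y)) E)

thinRGraph? : ∀ s t n r → Decidable (ThinRGraph s t n r)
thinRGraph? s t n r m = anyVec? λ E → isRGraph? r E ×-dec
  allSubset? λ S → ∣ S ∣ ≟ s →-dec atLeast? t S (hasOwnVertex? E S)

-- The greatest k ≤ b satisfying P; the value 0 is also returned if there is
-- no such k.
greatest : {P : Pred ℕ a} → Decidable P → ℕ → ℕ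
greatest P? zero    = zero
greatest P? (suc b) with P? (suc b)
... | yes _ = suc b
... | no  _ = greatest P? b

-- There are only 2 ^ n subsets of Fin n, so the search bound excludes nothing.
L : (s t n r : ℕ) → ℕ
L s t n r = greatest (thinRGraph? s t n r) (2 ^ n)

record IsMaximum (P : Pred ℕ a) (k : ℕ) : Set a where
  field
    attained : P k
    bound    : ∀ m → P m → m ≤ k

private
  greatest-isMaximum : {P : Pred ℕ a} (P? : Decidable P) → P 0 →
                       ∀ b → (∀ m → P m → m ≤ b) → IsMaximum P (greatest P? b)
  greatest-isMaximum P? p₀ zero    ub = record { attained = p₀ ; bound = ub }
  greatest-isMaximum P? p₀ (suc b) ub with P? (suc b)
  ... | yes p = record { attained = p ; bound = ub }
  ... | no ¬p = greatest-isMaximum P? p₀ b λ m pm →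
    ≤-pred (≤∧≢⇒< (ub m pm) λ { refl → ¬p pm })

  code : Subset n → Fin (2 ^ n)
  code p = funToFin (Inverse.from 2↔Bool ∘ lookup p)

  code-injective : {p q : Subset n} → code p ≡ code q → p ≡ q
  code-injective {p = p} {q} eq = begin
    p                              ≡⟨ tabulate∘lookup p ⟨
    Data.Vec.tabulate (lookup p)   ≡⟨ tabulate-cong pointwise ⟩
    Data.Vec.tabulate (lookup q)   ≡⟨ tabulate∘lookup q ⟩
    q                              ∎
    where
    open ≡-Reasoning
    digit : ∀ i → Inverse.from 2↔Bool (lookup p i) ≡ Inverse.from 2↔Bool (lookup q i)
    digit i = trans (sym (finToFun-funToFin (Inverse.from 2↔Bool ∘ lookup p) i))
      (trans (cong (λ c → Data.Fin.finToFun c i) eq)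
             (finToFun-funToFin (Inverse.from 2↔Bool ∘ lookup q) i))
    pointwise : ∀ i → lookup p i ≡ lookup q i
    pointwise i = trans (sym (Inverse.strictlyInverseˡ 2↔Bool _))
      (trans (cong (Inverse.to 2↔Bool) (digit i))
             (Inverse.strictlyInverseˡ 2↔Bool _))

  size≤2^n : ∀ {s t n r} m → ThinRGraph s t n r m → m ≤ 2 ^ n
  size≤2^n m (E , G , _) = injective⇒≤ {f = code ∘ lookup E} λ {i} {j} eq →
    lookup-injective (IsRGraph.distinct G) i j (code-injective eq)

  emptyThin : ∀ {s t n r} → 1 ≤ s → ThinRGraph s t n r 0
  emptyThin 1≤s = [] , record { uniform = [] ; distinct = [] } ,
    λ S ∣S∣≡s → contradiction (≤-trans 1≤s (subst (_≤ 0) ∣S∣≡s (∣p∣≤n S))) λ ()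

L-isMaximum : ∀ {s t n r} → 1 ≤ s → IsMaximum (ThinRGraph s t n r) (L s t n r)
L-isMaximum {s} {t} {n} {r} 1≤s =
  greatest-isMaximum (thinRGraph? s t n r) (emptyThin 1≤s) (2 ^ n) size≤2^n

⌈_/_⌉ : (m d : ℕ) .{{_ : NonZero d}} → ℕ
⌈ m / d ⌉ = (m + pred d) / d

-- ⌊ (2s - t - 1) / (s - t + 1) ⌋; for t < s no subtraction is truncated.
quot : (s t : ℕ) → ℕ
quot s t = (2 * s ∸ t ∸ 1) / suc (s ∸ t)

quot-nonZero : ∀ {s t} → 1 ≤ t → t < s → NonZero (quot s t)
quot-nonZero {s} {t} 1≤t t<s = >-nonZero (m≥n⇒m/n>0 (begin
  suc (s ∸ t)           ≤⟨ +-monoˡ-≤ (s ∸ t) (∸-monoˡ-≤ 1 (≤-trans (s≤s 1≤t) t<s)) ⟩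
  (s ∸ 1) + (s ∸ t)     ≡⟨ +-comm (s ∸ 1) (s ∸ t) ⟩
  (s ∸ t) + (s ∸ 1)     ≡⟨ +-∸-assoc (s ∸ t) (≤-trans (s≤s z≤n) t<s) ⟨
  (s ∸ t + s) ∸ 1       ≡⟨ cong (_∸ 1) (+-∸-comm s (<⇒≤ t<s)) ⟨
  (s + s ∸ t) ∸ 1       ≡⟨ cong (λ x → s + x ∸ t ∸ 1) (+-identityʳ s) ⟨
  2 * s ∸ t ∸ 1         ∎))
  where open ≤-Reasoning

ℓ : (s t r : ℕ) → .(1 ≤ t) → .(t < s) → ℕ
ℓ s t r 1≤t t<s = ⌈ r / quot s t ⌉ {{quot-nonZero 1≤t t<s}}

{-# OPTIONS --safe #-}

-- Put k = s - t + 1 and write the denominator of ℓ as p + 1, so that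
-- k p + 2 ≤ s and r ≤ (p + 1) ℓ.  If the graph has more than (s - 1) C(n, ℓ)
-- edges, repeatedly deleting all edges through an ℓ-set of degree at most s - 1
-- leaves a nonempty subfamily in which every ℓ-set lying in an edge lies in at
-- least s edges, so that a further edge through it can always be found as long
-- as fewer than s edges are in use.  Start from two edges with a common ℓ-set,
-- and k times cover one of the edges already in use by the others: it shares
-- an ℓ-set with one of them, so p new edges suffice, and each of these again
-- shares an ℓ-set with an edge in use.  This gives at most k p + 2 ≤ s edges, k
-- of which have no own vertex; hence fewer than t of some s edges have one.
-- For p ≥ 1 there are always more edges in use than covered ones; for p = 0
-- already the two edges with a common ℓ-set cannot exist, as then ℓ = r.
module Submission where

open import Defs
open import Data.Fin using (Fin)
open import Data.Fin.Properties using (any?)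
open import Data.Fin.Subset
open import Data.Fin.Subset.Properties
open import Data.List using (List; []; _∷_; _++_; length; map)
open import Data.List.Properties using (length-++; length-++-sucʳ; length-map)
open import Data.List.Membership.Propositional using (find; lose) renaming (_∈_ to _∈ˡ_)
open import Data.List.Membership.Propositional.Properties
  using (∈-++⁺ˡ; ∈-++⁺ʳ; ∈-++⁻; ∈-map⁺; ∈-∃++)
open import Data.List.Relation.Unary.Any using (here; there) renaming (any? to anyˡ?)
open import Data.Nat
  using (ℕ; zero; suc; pred; _+_; _*_; _∸_; _≤_; _<_; z≤n; s≤s; s≤s⁻¹; z<s; NonZero; _≤?_)
open import Data.Nat.Combinatorics using (_C_; nCk+nC[k+1]≡[n+1]C[k+1])
open import Data.Nat.DivMod using (_/_; _%_; m≡m%n+[m/n]*n; m%n<n; m/n*n≤m; m<n*o⇒m/o<n)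
open import Data.Nat.Properties
open import Data.Product using (∃-syntax; _×_; _,_)
open import Data.Sum using (inj₁; inj₂)
open import Data.Vec using (Vec; []; _∷_; lookup)
import Data.Vec as Vec
open import Data.Vec.Membership.Propositional.Properties using (∈-lookup)
import Data.Vec.Relation.Unary.All as All
open import Data.Vec.Properties using (lookup-map; []=⇒lookup; lookup⇒[]=)
open import Data.Vec.Relation.Unary.Unique.Propositional.Properties using (lookup-injective)
open import Function using (_∘_)
open import Relation.Binary.PropositionalEquality
open import Relation.Nullary
open import Relation.Nullary.Decidable using (dec-true; ¬?; _×-dec_; decidable-stable)

open ≤-Reasoning

private variable
  n m r s t k : ℕ
  A B P Q X : Subset n

-- Cardinalities of finite subsets

∣p∩q∣+∣p─q∣≡∣p∣ : (P Q : Subset n) → ∣ P ∩ Q ∣ + ∣ P ─ Q ∣ ≡ ∣ P ∣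
∣p∩q∣+∣p─q∣≡∣p∣ []            []            = refl
∣p∩q∣+∣p─q∣≡∣p∣ (inside ∷ P)  (inside ∷ Q)  = cong suc (∣p∩q∣+∣p─q∣≡∣p∣ P Q)
∣p∩q∣+∣p─q∣≡∣p∣ (inside ∷ P)  (outside ∷ Q) =
  trans (+-suc _ _) (cong suc (∣p∩q∣+∣p─q∣≡∣p∣ P Q))
∣p∩q∣+∣p─q∣≡∣p∣ (outside ∷ P) (inside ∷ Q)  = ∣p∩q∣+∣p─q∣≡∣p∣ P Q
∣p∩q∣+∣p─q∣≡∣p∣ (outside ∷ P) (outside ∷ Q) = ∣p∩q∣+∣p─q∣≡∣p∣ P Q

x∉p⇒∣p∪⁅x⁆∣≡1+∣p∣ : ∀ (P : Subset n) {x} → x ∉ P → ∣ P ∪ ⁅ x ⁆ ∣ ≡ suc ∣ P ∣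
x∉p⇒∣p∪⁅x⁆∣≡1+∣p∣ (inside ∷ P)  {Fin.zero}  x∉P = contradiction Vec.here x∉P
x∉p⇒∣p∪⁅x⁆∣≡1+∣p∣ (outside ∷ P) {Fin.zero}  x∉P = cong (suc ∘ ∣_∣) (∪-identityʳ P)
x∉p⇒∣p∪⁅x⁆∣≡1+∣p∣ (inside ∷ P)  {Fin.suc x} x∉P = cong suc (x∉p⇒∣p∪⁅x⁆∣≡1+∣p∣ P (x∉P ∘ Vec.there))
x∉p⇒∣p∪⁅x⁆∣≡1+∣p∣ (outside ∷ P) {Fin.suc x} x∉P = x∉p⇒∣p∪⁅x⁆∣≡1+∣p∣ P (x∉P ∘ Vec.there)

p⊆r∧q⊆r⇒p∪q⊆r : {R : Subset n} → P ⊆ R → Q ⊆ R → P ∪ Q ⊆ R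
p⊆r∧q⊆r⇒p∪q⊆r {P = P} {Q} P⊆R Q⊆R x∈ with x∈p∪q⁻ P Q x∈
... | inj₁ x∈P = P⊆R x∈P
... | inj₂ x∈Q = Q⊆R x∈Q

x∈p⇒⁅x⁆⊆p : {x : Fin n} → x ∈ P → ⁅ x ⁆ ⊆ P
x∈p⇒⁅x⁆⊆p {P = P} x∈P y∈ = subst (_∈ P) (sym (x∈⁅y⁆⇒x≡y _ y∈)) x∈P

x∈p─q⇒x∉q : ∀ (P Q : Subset n) {x} → x ∈ P ─ Q → x ∉ Q
x∈p─q⇒x∉q (_ ∷ P) (outside ∷ Q) (Vec.there x∈) (Vec.there x∈Q) = x∈p─q⇒x∉q P Q x∈ x∈Q
x∈p─q⇒x∉q (_ ∷ P) (inside ∷ Q)  (Vec.there x∈) (Vec.there x∈Q) = x∈p─q⇒x∉q P Q x∈ x∈Q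

empty⇒∣p∣≡0 : ∀ {n} {P : Subset n} → Empty P → ∣ P ∣ ≡ 0
empty⇒∣p∣≡0 {n} empty = trans (cong ∣_∣ (Empty-unique empty)) (∣⊥∣≡0 n)

0<∣p∣⇒nonempty : 0 < ∣ P ∣ → Nonempty P
0<∣p∣⇒nonempty {P = P} 0<∣P∣ = decidable-stable (nonempty? P) λ empty →
  <-irrefl (sym (empty⇒∣p∣≡0 empty)) 0<∣P∣

∣p∣<∣q∣⇒∃∈q∖p : ∣ P ∣ < ∣ Q ∣ → ∃[ x ] x ∈ Q × x ∉ P
∣p∣<∣q∣⇒∃∈q∖p {P = P} {Q} lt =
  decidable-stable (any? λ x → x ∈? Q ×-dec ¬? (x ∈? P)) λ none →
    <⇒≱ lt (p⊆q⇒∣p∣≤∣q∣ λ {x} x∈Q →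
      decidable-stable (x ∈? P) λ x∉P → none (x , x∈Q , x∉P))

p⊆q∧∣p∣≡∣q∣⇒p≡q : P ⊆ Q → ∣ P ∣ ≡ ∣ Q ∣ → P ≡ Q
p⊆q∧∣p∣≡∣q∣⇒p≡q {P = P} P⊆Q eq = ⊆-antisym P⊆Q λ {x} x∈Q →
  decidable-stable (x ∈? P) λ x∉P → <-irrefl eq (p⊂q⇒∣p∣<∣q∣ (P⊆Q , x , x∈Q , x∉P))

interpolate : P ⊆ Q → ∣ P ∣ ≤ k → k ≤ ∣ Q ∣ → ∃[ R ] P ⊆ R × R ⊆ Q × ∣ R ∣ ≡ k
interpolate {P = P} {k = k} P⊆Q ∣P∣≤k k≤∣Q∣ = go (k ∸ ∣ P ∣) P⊆Q (m∸n+n≡m ∣P∣≤k) k≤∣Q∣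
  where
  go : ∀ d {P Q : Subset n} → P ⊆ Q → d + ∣ P ∣ ≡ k → k ≤ ∣ Q ∣ →
       ∃[ R ] P ⊆ R × R ⊆ Q × ∣ R ∣ ≡ k
  go zero    {P} P⊆Q eq k≤ = P , ⊆-refl , P⊆Q , eq
  go (suc d) {P} P⊆Q eq k≤
    with x , x∈Q , x∉P ← ∣p∣<∣q∣⇒∃∈q∖p (≤-trans (≤-trans (s≤s (m≤n+m ∣ P ∣ d)) (≤-reflexive eq)) k≤)
    with R , P∪x⊆R , R⊆Q , ∣R∣≡k ←
           go d (p⊆r∧q⊆r⇒p∪q⊆r P⊆Q (x∈p⇒⁅x⁆⊆p x∈Q))
             (trans (cong (d +_) (x∉p⇒∣p∪⁅x⁆∣≡1+∣p∣ P x∉P)) (trans (+-suc d _) eq)) k≤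
    = R , ⊆-trans (p⊆p∪q _) P∪x⊆R , R⊆Q , ∣R∣≡k

∣x─a∣≤∣x∣∸∣a∣ : A ⊆ X → ∣ X ─ A ∣ ≤ ∣ X ∣ ∸ ∣ A ∣
∣x─a∣≤∣x∣∸∣a∣ {A = A} {X} A⊆X = m+n≤o⇒m≤o∸n ∣ X ─ A ∣ (begin
  ∣ X ─ A ∣ + ∣ A ∣      ≡⟨ +-comm ∣ X ─ A ∣ ∣ A ∣ ⟩
  ∣ A ∣ + ∣ X ─ A ∣      ≤⟨ +-monoˡ-≤ _ (p⊆q⇒∣p∣≤∣q∣ λ a → x∈p∩q⁺ (A⊆X a , a)) ⟩
  ∣ X ∩ A ∣ + ∣ X ─ A ∣  ≡⟨ ∣p∩q∣+∣p─q∣≡∣p∣ X A ⟩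
  ∣ X ∣                  ∎)

-- If `X` is small, it is enlarged inside `P` and nothing of it remains; otherwise `A` is cut out of
-- `X`. Either way `A` has exactly `k` elements, as richness requires, even where fewer are left to
-- cover.
subsetMeeting : ∀ {n k} {X P : Subset n} → X ⊆ P → k ≤ ∣ P ∣ → ∃[ A ] A ⊆ P × ∣ A ∣ ≡ k × ∣ X ─ A ∣ ≤ ∣ X ∣ ∸ k
subsetMeeting {n} {k} {X} X⊆P k≤∣P∣ with ≤-total ∣ X ∣ k
... | inj₁ ∣X∣≤k with A , X⊆A , A⊆P , ∣A∣≡k ← interpolate X⊆P ∣X∣≤k k≤∣P∣ =
  A , A⊆P , ∣A∣≡k , ≤-trans (≤-reflexive (empty⇒∣p∣≡0 empty)) z≤n
  where
  empty : Empty (X ─ A)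
  empty (x , x∈) = x∈p─q⇒x∉q X A x∈ (X⊆A (p─q⊆p X A x∈))
... | inj₂ k≤∣X∣
  with A , _ , A⊆X , refl ← interpolate (⊆-min X) (≤-trans (≤-reflexive (∣⊥∣≡0 n)) z≤n) k≤∣X∣ =
  A , ⊆-trans A⊆X X⊆P , refl , ∣x─a∣≤∣x∣∸∣a∣ A⊆X

-- The subsets of given size and the deletion argument

kSubsets : ∀ n → ℕ → List (Subset n)
kSubsets n       zero    = ⊥ ∷ []
kSubsets zero    (suc k) = []
kSubsets (suc n) (suc k) = map (inside ∷_) (kSubsets n k) ++ map (outside ∷_) (kSubsets n (suc k))

length-kSubsets : ∀ n k → length (kSubsets n k) ≡ n C k
length-kSubsets n       zero    = refl
length-kSubsets zero    (suc k) = refl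
length-kSubsets (suc n) (suc k) = begin-equality
  length (map (inside ∷_) (kSubsets n k) ++ map (outside ∷_) (kSubsets n (suc k)))
    ≡⟨ length-++ (map (inside ∷_) (kSubsets n k)) ⟩
  length (map (inside ∷_) (kSubsets n k)) + length (map (outside ∷_) (kSubsets n (suc k)))
    ≡⟨ cong₂ _+_ (trans (length-map _ (kSubsets n k)) (length-kSubsets n k))
                 (trans (length-map _ (kSubsets n (suc k))) (length-kSubsets n (suc k))) ⟩
  n C k + n C suc k
    ≡⟨ nCk+nC[k+1]≡[n+1]C[k+1] n k ⟩
  suc n C suc k ∎

∈-kSubsets : ∀ k (P : Subset n) → ∣ P ∣ ≡ k → P ∈ˡ kSubsets n k
∈-kSubsets zero    P eq = here (Empty-unique λ (x , x∈P) →
  <-irrefl (sym eq) (≤-trans (≤-reflexive (sym (∣⁅x⁆∣≡1 x))) (p⊆q⇒∣p∣≤∣q∣ (x∈p⇒⁅x⁆⊆p x∈P))))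
∈-kSubsets (suc k) (inside ∷ P)  eq = ∈-++⁺ˡ (∈-map⁺ _ (∈-kSubsets k P (suc-injective eq)))
∈-kSubsets (suc k) (outside ∷ P) eq =
  ∈-++⁺ʳ (map (inside ∷_) (kSubsets _ k)) (∈-map⁺ _ (∈-kSubsets (suc k) P eq))

-- As long as some listed set meets `F` in at most `d` elements, these leave `F` and the set leaves
-- the list. The left side of the inequality drops by exactly `d` and the right side by at most `d`,
-- so the inequality survives and `F` never becomes empty.
prune : ∀ d (Ps : List (Subset m)) (F : Subset m) → d * length Ps < ∣ F ∣ →
        ∃[ F′ ] Nonempty F′ × (∀ {P} → P ∈ˡ Ps → Nonempty (F′ ∩ P) → d < ∣ F′ ∩ P ∣)
prune {m} d Ps F lt = let F′ , _ , good = go _ Ps F refl lt in F′ , good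
  where
  -- The recursion runs on the length `N`, since `Us ++ Vs` is not a structural part of
  -- `Us ++ P ∷ Vs`.
  go : ∀ N (Ps : List (Subset m)) F → length Ps ≡ N → d * N < ∣ F ∣ →
       ∃[ F′ ] F′ ⊆ F × Nonempty F′ × (∀ {P} → P ∈ˡ Ps → Nonempty (F′ ∩ P) → d < ∣ F′ ∩ P ∣)
  go N Ps F eq lt with anyˡ? (λ P → ∣ F ∩ P ∣ ≤? d) Ps
  ... | no ¬sparse =
    F , ⊆-refl , 0<∣p∣⇒nonempty (≤-trans z<s lt) , λ P∈ _ → ≰⇒> λ sparse → ¬sparse (lose P∈ sparse)
  ... | yes sparse with P , P∈ , ∣F∩P∣≤d ← find sparse with Us , Vs , refl ← ∈-∃++ P∈
    with N | trans (sym (length-++-sucʳ Us P Vs)) eq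
  ...   | suc N | eq′
    with F′ , F′⊆F─P , nonempty , dense ← go N (Us ++ Vs) (F ─ P) (suc-injective eq′)
           (+-cancelˡ-< d _ _ (begin-strict
             d + d * N              ≡⟨ *-suc d N ⟨
             d * suc N              <⟨ lt ⟩
             ∣ F ∣                  ≡⟨ ∣p∩q∣+∣p─q∣≡∣p∣ F P ⟨
             ∣ F ∩ P ∣ + ∣ F ─ P ∣  ≤⟨ +-monoˡ-≤ _ ∣F∩P∣≤d ⟩
             d + ∣ F ─ P ∣          ∎))
    = F′ , ⊆-trans F′⊆F─P (p─q⊆p F P) , nonempty , dense′
    where
    dense′ : ∀ {R} → R ∈ˡ Us ++ P ∷ Vs → Nonempty (F′ ∩ R) → d < ∣ F′ ∩ R ∣
    dense′ R∈ ne with ∈-++⁻ Us R∈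
    dense′ R∈ ne       | inj₁ R∈Us         = dense (∈-++⁺ˡ R∈Us) ne
    dense′ R∈ ne       | inj₂ (there R∈Vs) = dense (∈-++⁺ʳ Us R∈Vs) ne
    -- A discarded set no longer meets the family, so the demand on it is vacuous.
    dense′ R∈ (x , x∈) | inj₂ (here refl)  with x∈F′ , x∈P ← x∈p∩q⁻ F′ P x∈ =
      contradiction x∈P (x∈p─q⇒x∉q F P (F′⊆F─P x∈F′))

-- Degrees and links between edges

star : Vec (Subset n) m → Subset n → Subset m
star E A = Vec.map (λ e → does (A ⊆? e)) E

∈-star⁺ : ∀ (E : Vec (Subset n) m) i → A ⊆ lookup E i → i ∈ star E A
∈-star⁺ {A = A} E i A⊆ = lookup⇒[]= i _ (trans (lookup-map i _ E) (dec-true (A ⊆? lookup E i) A⊆))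

∈-star⁻ : ∀ (E : Vec (Subset n) m) i → i ∈ star E A → A ⊆ lookup E i
∈-star⁻ {A = A} E i i∈ with A ⊆? lookup E i | trans (sym (lookup-map i (λ e → does (A ⊆? e)) E)) ([]=⇒lookup i∈)
... | yes A⊆ | _ = A⊆

-- Here and below `k` is the size called ℓ in the theorem; `∣ F ∩ star E A ∣` is the degree of `A`
-- in the subfamily `F`.
Rich : Vec (Subset n) m → Subset m → ℕ → ℕ → Set
Rich E F k s = ∀ {i A} → i ∈ F → A ⊆ lookup E i → ∣ A ∣ ≡ k → s ≤ ∣ F ∩ star E A ∣

-- With `X` the whole edge `i`, this is the failure of `HasOwnVertex E S i`; general `X` allows an
-- edge to be covered piece by piece.
Covered : Vec (Subset n) m → Subset m → Fin m → Subset n → Set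
Covered E S i X = ∀ {v} → v ∈ X → ∃[ j ] j ∈ S × j ≢ i × v ∈ lookup E j

-- `linked` is the invariant of the construction: `k` vertices of any edge are already covered, so
-- that `p` rather than `p + 1` new edges suffice for the rest.
record Cluster (E : Vec (Subset n) m) (F : Subset m) (k : ℕ) (S : Subset m) : Set where
  field
    ⊆family : S ⊆ F
    linked  : ∀ {i} → i ∈ S → ∃[ j ] ∃[ A ]
              j ∈ S × j ≢ i × ∣ A ∣ ≡ k × A ⊆ lookup E i × A ⊆ lookup E j

open Cluster

-- Deletion with `d = s - 1` starts from all `m` edges and lists the stars of the `n C k` sets of
-- size `k`; a star still met is then met more than `s - 1` times.
∃-rich : ∀ (E : Vec (Subset n) m) k s → (s ∸ 1) * (n C k) < m →
         ∃[ F ] Nonempty F × Rich E F k s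
∃-rich {n} {m} E k s lt
  with F , nonempty , dense ← prune (s ∸ 1) (map (star E) (kSubsets n k)) ⊤
         (subst₂ (λ x y → (s ∸ 1) * x < y)
           (sym (trans (length-map (star E) (kSubsets n k)) (length-kSubsets n k)))
           (sym (∣⊤∣≡n m)) lt)
  = F , nonempty , λ {i} {A} i∈F A⊆ ∣A∣≡k →
    ≤-trans (m≤n+m∸n s 1)
      (dense (∈-map⁺ (star E) (∈-kSubsets k A ∣A∣≡k)) (i , x∈p∩q⁺ (i∈F , ∈-star⁺ E i A⊆)))

-- Growing a cluster inside a rich family

module _ {E : Vec (Subset n) m} {F : Subset m} (rich : Rich E F k s) where

  fresh : ∀ {i} {S : Subset m} → i ∈ F → A ⊆ lookup E i → ∣ A ∣ ≡ k → ∣ S ∣ < s →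
          ∃[ j ] j ∈ F × A ⊆ lookup E j × j ∉ S
  fresh {A = A} i∈F A⊆ ∣A∣≡k ∣S∣<s
    with j , j∈ , j∉S ← ∣p∣<∣q∣⇒∃∈q∖p (≤-trans ∣S∣<s (rich i∈F A⊆ ∣A∣≡k))
    with j∈F , j∈star ← x∈p∩q⁻ F (star E A) j∈
    = j , j∈F , ∈-star⁻ E j j∈star , j∉S

  adjoin : ∀ {i j} {S : Subset m} → Cluster E F k S → i ∈ S → j ∈ F → j ∉ S →
           ∣ A ∣ ≡ k → A ⊆ lookup E i → A ⊆ lookup E j → Cluster E F k (S ∪ ⁅ j ⁆)
  adjoin {A = A} {i} {j} {S} cl i∈S j∈F j∉S ∣A∣≡k A⊆i A⊆j = record
    { ⊆family = p⊆r∧q⊆r⇒p∪q⊆r (⊆family cl) (x∈p⇒⁅x⁆⊆p j∈F)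
    ; linked  = link
    }
    where
    link : ∀ {h} → h ∈ S ∪ ⁅ j ⁆ → ∃[ g ] ∃[ A ]
           g ∈ S ∪ ⁅ j ⁆ × g ≢ h × ∣ A ∣ ≡ k × A ⊆ lookup E h × A ⊆ lookup E g
    link h∈ with x∈p∪q⁻ S ⁅ j ⁆ h∈
    ... | inj₁ h∈S with g , A′ , g∈S , rest ← linked cl h∈S = g , A′ , p⊆p∪q _ g∈S , rest
    ... | inj₂ h∈j with refl ← x∈⁅y⁆⇒x≡y j h∈j =
      i , A , p⊆p∪q _ i∈S , (λ { refl → j∉S i∈S }) , ∣A∣≡k , A⊆j , A⊆i

  -- Each new edge takes up to `k` vertices off what is left of `X`. It passes through a `k`-set
  -- inside edge `i`, hence is linked to `i`, and the invariant survives.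
  coverBy : ∀ p {i} {S : Subset m} → k ≤ ∣ lookup E i ∣ → Cluster E F k S → i ∈ S →
            X ⊆ lookup E i → ∣ X ∣ ≤ p * k → p + ∣ S ∣ ≤ s →
            ∃[ S′ ] Cluster E F k S′ × S ⊆ S′ × ∣ S′ ∣ ≡ p + ∣ S ∣ × Covered E S′ i X
  coverBy {X = X} zero {S = S} _ cl _ _ ∣X∣≤0 _ =
    S , cl , ⊆-refl , refl , λ {v} v∈X →
      contradiction (≤-trans (p⊆q⇒∣p∣≤∣q∣ (x∈p⇒⁅x⁆⊆p v∈X)) ∣X∣≤0)
        (<⇒≱ (≤-reflexive (sym (∣⁅x⁆∣≡1 v))))
  coverBy {X = X} (suc p) {i} {S} k≤ cl i∈S X⊆ ∣X∣≤ room
    with A , A⊆i , ∣A∣≡k , ∣X─A∣≤ ← subsetMeeting X⊆ k≤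
    with j , j∈F , A⊆j , j∉S ← fresh (⊆family cl i∈S) A⊆i ∣A∣≡k (≤-trans (s≤s (m≤n+m _ p)) room)
    with eq ← trans (cong (p +_) (x∉p⇒∣p∪⁅x⁆∣≡1+∣p∣ S j∉S)) (+-suc p ∣ S ∣)
    with S′ , cl′ , ⊆S′ , ∣S′∣≡ , cov ←
           coverBy p k≤ (adjoin cl i∈S j∈F j∉S ∣A∣≡k A⊆i A⊆j) (p⊆p∪q _ i∈S)
             (⊆-trans (p─q⊆p X A) X⊆)
             (≤-trans ∣X─A∣≤ (≤-trans (∸-monoˡ-≤ k ∣X∣≤) (≤-reflexive (m+n∸m≡n k (p * k)))))
             (≤-trans (≤-reflexive eq) room)
    = S′ , cl′ , ⊆-trans (p⊆p∪q _) ⊆S′ , trans ∣S′∣≡ eq , cov′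
    where
    cov′ : Covered E S′ i X
    cov′ {v} v∈X with v ∈? A
    ... | yes v∈A = j , ⊆S′ (q⊆p∪q _ _ (x∈⁅x⁆ j)) , (λ { refl → j∉S i∈S }) , A⊆j v∈A
    ... | no  v∉A = cov (x∈p∧x∉q⇒x∈p─q v∈X v∉A)

  module _ (uniform : ∀ i → ∣ lookup E i ∣ ≡ r) (k≤r : k ≤ r) where

    private
      k≤∣e∣ : ∀ i → k ≤ ∣ lookup E i ∣
      k≤∣e∣ i = ≤-trans k≤r (≤-reflexive (sym (uniform i)))

    -- Induction on `j`, the number of fully covered edges collected in `B`: two edges to start
    -- with, and `p` more for each further member of `B`.
    grow : ∀ p → r ≤ suc p * k → 1 ≤ p → Nonempty F → ∀ j → j * p + 2 ≤ s →
           ∃[ S ] ∃[ B ] Cluster E F k S × ∣ S ∣ ≡ j * p + 2 × B ⊆ S × ∣ B ∣ ≡ j ×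
                         (∀ {i} → i ∈ B → Covered E S i (lookup E i))
    grow p r≤ 1≤p (i , i∈F) zero 2≤s
      with A , A⊆i , ∣A∣≡k , _ ← subsetMeeting (⊆-min (lookup E i)) (k≤∣e∣ i)
      with j , j∈F , A⊆j , j∉i ← fresh i∈F A⊆i ∣A∣≡k (≤-trans (s≤s (≤-reflexive (∣⁅x⁆∣≡1 i))) 2≤s)
      = ⁅ i ⁆ ∪ ⁅ j ⁆ , ⊥ , record
        { ⊆family = p⊆r∧q⊆r⇒p∪q⊆r (x∈p⇒⁅x⁆⊆p i∈F) (x∈p⇒⁅x⁆⊆p j∈F)
        ; linked  = link
        } , trans (x∉p⇒∣p∪⁅x⁆∣≡1+∣p∣ ⁅ i ⁆ j∉i) (cong suc (∣⁅x⁆∣≡1 i)) , ⊆-min _ , ∣⊥∣≡0 m ,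
        λ x∈⊥ → contradiction x∈⊥ ∉⊥
      where
      j≢i : j ≢ i
      j≢i refl = j∉i (x∈⁅x⁆ i)
      link : ∀ {h} → h ∈ ⁅ i ⁆ ∪ ⁅ j ⁆ → ∃[ g ] ∃[ A ]
             g ∈ ⁅ i ⁆ ∪ ⁅ j ⁆ × g ≢ h × ∣ A ∣ ≡ k × A ⊆ lookup E h × A ⊆ lookup E g
      link h∈ with x∈p∪q⁻ ⁅ i ⁆ ⁅ j ⁆ h∈
      ... | inj₁ h∈i with refl ← x∈⁅y⁆⇒x≡y i h∈i =
        j , A , q⊆p∪q ⁅ i ⁆ _ (x∈⁅x⁆ j) , j≢i , ∣A∣≡k , A⊆i , A⊆j
      ... | inj₂ h∈j with refl ← x∈⁅y⁆⇒x≡y j h∈j =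
        i , A , p⊆p∪q _ (x∈⁅x⁆ i) , j≢i ∘ sym , ∣A∣≡k , A⊆j , A⊆i
    grow p r≤ 1≤p nonempty (suc j) room
      with room′ ← ≤-trans (≤-reflexive (sym (+-assoc p (j * p) 2))) room
      with S , B , cl , ∣S∣≡ , B⊆S , ∣B∣≡j , cov ←
             grow p r≤ 1≤p nonempty j (≤-trans (m≤n+m _ p) room′)
      -- An edge outside `B` is available because `1 ≤ p` makes `j * p + 2` exceed `j`.
      with i , i∈S , i∉B ← ∣p∣<∣q∣⇒∃∈q∖p (subst₂ _<_ (sym ∣B∣≡j) (sym ∣S∣≡) (begin-strict
             j         ≡⟨ *-identityʳ j ⟨
             j * 1     ≤⟨ *-monoʳ-≤ j 1≤p ⟩
             j * p     <⟨ m<m+n (j * p) z<s ⟩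
             j * p + 2 ∎))
      -- The link gives `A`, already covered by `g`; at most `r - k`, hence at most `p * k`,
      -- vertices of edge `i` remain.
      with g , A , g∈S , g≢i , ∣A∣≡k , A⊆i , A⊆g ← linked cl i∈S
      with S′ , cl′ , S⊆S′ , ∣S′∣≡ , covᵢ ←
             coverBy p (k≤∣e∣ i) cl i∈S (p─q⊆p (lookup E i) A) (begin
               ∣ lookup E i ─ A ∣        ≤⟨ ∣x─a∣≤∣x∣∸∣a∣ A⊆i ⟩
               ∣ lookup E i ∣ ∸ ∣ A ∣    ≡⟨ cong₂ _∸_ (uniform i) ∣A∣≡k ⟩
               r ∸ k                     ≤⟨ ∸-monoˡ-≤ k r≤ ⟩
               (k + p * k) ∸ k           ≡⟨ m+n∸m≡n k (p * k) ⟩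
               p * k                     ∎)
               (≤-trans (≤-reflexive (cong (p +_) ∣S∣≡)) room′)
      = S′ , B ∪ ⁅ i ⁆ , cl′ ,
        trans ∣S′∣≡ (trans (cong (p +_) ∣S∣≡) (sym (+-assoc p (j * p) 2))) ,
        p⊆r∧q⊆r⇒p∪q⊆r (⊆-trans B⊆S S⊆S′) (x∈p⇒⁅x⁆⊆p (S⊆S′ i∈S)) ,
        trans (x∉p⇒∣p∪⁅x⁆∣≡1+∣p∣ B i∉B) (cong suc ∣B∣≡j) , cov′
      where
      cov′ : ∀ {h} → h ∈ B ∪ ⁅ i ⁆ → Covered E S′ h (lookup E h)
      cov′ h∈ {v} v∈ with x∈p∪q⁻ B ⁅ i ⁆ h∈
      cov′ h∈ {v} v∈ | inj₁ h∈B with f , f∈S , rest ← cov h∈B v∈ = f , S⊆S′ f∈S , rest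
      cov′ h∈ {v} v∈ | inj₂ h∈i with refl ← x∈⁅y⁆⇒x≡y i h∈i with v ∈? A
      ... | yes v∈A = g , S⊆S′ g∈S , g≢i , A⊆g v∈A
      ... | no  v∉A = covᵢ (x∈p∧x∉q⇒x∈p─q v∈ v∉A)

-- Contradiction with local thinness

-- `S` is padded with arbitrary edges to exactly `s`, and covered edges stay covered. The edges `T`
-- with own vertices therefore avoid `B`, which would force `j + t ≤ s`.
covered⇒¬thin : ∀ {E : Vec (Subset n) m} {S B} j → ∣ S ∣ ≤ s → s ≤ m → s < j + t →
                B ⊆ S → ∣ B ∣ ≡ j → (∀ {i} → i ∈ B → Covered E S i (lookup E i)) →
                ¬ LocallyThin s t E
covered⇒¬thin {m = m} {s} {t} {E} {S} {B} j ∣S∣≤s s≤m s<j+t B⊆S ∣B∣≡j cov thin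
  with S′ , S⊆S′ , _ , ∣S′∣≡s ← interpolate (⊆-max S) ∣S∣≤s (≤-trans s≤m (≤-reflexive (sym (∣⊤∣≡n m))))
  with T , T⊆S′ , t≤∣T∣ , own ← thin S′ ∣S′∣≡s
  = <⇒≱ s<j+t (begin
      j + t                    ≤⟨ +-mono-≤ (≤-reflexive (sym ∣B∣≡j)) t≤∣T∣ ⟩
      ∣ B ∣ + ∣ T ∣            ≤⟨ +-mono-≤ (p⊆q⇒∣p∣≤∣q∣ λ b → x∈p∩q⁺ (S⊆S′ (B⊆S b) , b))
                                          (p⊆q⇒∣p∣≤∣q∣ λ b → x∈p∧x∉q⇒x∈p─q (T⊆S′ b) (T∌B b)) ⟩
      ∣ S′ ∩ B ∣ + ∣ S′ ─ B ∣  ≡⟨ ∣p∩q∣+∣p─q∣≡∣p∣ S′ B ⟩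
      ∣ S′ ∣                   ≡⟨ ∣S′∣≡s ⟩
      s                        ∎)
  where
  T∌B : ∀ {i} → i ∈ T → i ∉ B
  T∌B i∈T i∈B with v , v∈i , v∉ ← own _ i∈T with j , j∈S , j≢i , v∈j ← cov i∈B v∈i =
    v∉ j (S⊆S′ j∈S) j≢i v∈j

-- Exceeding the first summand of the bound makes `∃-rich` applicable; the second summand gives
-- `s ≤ m`, which leaves enough edges for the padding.
thin-size : ∀ {E : Vec (Subset n) m} p k j → IsRGraph r E → LocallyThin s t E →
            2 ≤ s → k ≤ r → r ≤ suc p * k → j * p + 2 ≤ s → s < j + t →
            m ≤ (s ∸ 1) * (n C k) + (s ∸ 1)
thin-size {n} {m} {r} {s} {t} {E} p k j G thin 2≤s k≤r r≤ room s<j+t = ≮⇒≥ λ large →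
  let F , nonempty , rich = ∃-rich E k s (≤-trans (s≤s (m≤m+n _ _)) large)
  in absurd p r≤ room (≤-trans (m≤n+m∸n s 1) (≤-trans (s≤s (m≤n+m _ _)) large)) rich nonempty
  where
  uniform : ∀ i → ∣ lookup E i ∣ ≡ r
  uniform i = All.lookup (IsRGraph.uniform G) (∈-lookup i E)
  absurd : ∀ p → r ≤ suc p * k → j * p + 2 ≤ s → s ≤ m →
           {F : Subset m} → Rich E F k s → ¬ Nonempty F
  -- Here `k = r`, so the edge is itself a `k`-set; richness gives a second edge containing it,
  -- which by its size is equal to it.
  absurd zero r≤ _ _ rich (i , i∈F)
    with j , _ , i⊆j , j∉i ← fresh {s = s} rich {S = ⁅ i ⁆} i∈F ⊆-refl
           (trans (uniform i) (≤-antisym (≤-trans r≤ (≤-reflexive (*-identityˡ k))) k≤r))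
           (≤-trans (s≤s (≤-reflexive (∣⁅x⁆∣≡1 i))) 2≤s)
    with refl ← lookup-injective (IsRGraph.distinct G) i j
           (p⊆q∧∣p∣≡∣q∣⇒p≡q i⊆j (trans (uniform i) (sym (uniform j))))
    = j∉i (x∈⁅x⁆ i)
  absurd (suc p) r≤ room s≤m rich nonempty
    with S , B , _ , ∣S∣≡ , B⊆S , ∣B∣≡j , cov ←
           grow rich uniform k≤r (suc p) r≤ (s≤s z≤n) nonempty j room
    = covered⇒¬thin {E = E} j (≤-trans (≤-reflexive ∣S∣≡) room) s≤m s<j+t B⊆S ∣B∣≡j cov thin

-- Arithmetic of the ceiling and the floor

-- After the match `d` is the amount that the ceiling adds before dividing; it absorbs the remainder
-- modulo `suc d`.
n≤⌈n/d⌉*d : ∀ n d .{{_ : NonZero d}} → n ≤ d * ⌈ n / d ⌉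
n≤⌈n/d⌉*d n (suc d) = +-cancelʳ-≤ d _ _ (begin
  n + d                                            ≡⟨ m≡m%n+[m/n]*n (n + d) (suc d) ⟩
  (n + d) % suc d + (n + d) / suc d * suc d        ≤⟨ +-monoˡ-≤ _ (s≤s⁻¹ (m%n<n (n + d) (suc d))) ⟩
  d + (n + d) / suc d * suc d                      ≡⟨ +-comm d _ ⟩
  (n + d) / suc d * suc d + d                      ≡⟨ cong (_+ d) (*-comm ((n + d) / suc d) (suc d)) ⟩
  suc d * ((n + d) / suc d) + d                    ∎)

⌈n/d⌉≤n : ∀ n d .{{_ : NonZero d}} → ⌈ n / d ⌉ ≤ n
⌈n/d⌉≤n n (suc d) = s≤s⁻¹ (m<n*o⇒m/o<n {n = suc n} (begin-strict
  n + d              ≡⟨ +-comm n d ⟩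
  d + n              <⟨ s≤s (+-monoʳ-≤ d (m≤m*n n (suc d))) ⟩
  suc n * suc d      ∎))

-- With `c = s - t + 1` the numerator `2s - t - 1` is `s + c - 2`, so the floor gives
-- `(p + 1) c ≤ s + c - 2`, and `c` is cancelled.
quot-bound : ∀ {s t} p → t < s → quot s t ≡ suc p → suc (s ∸ t) * p + 2 ≤ s
quot-bound {s} {t} p t<s eq = +-cancelʳ-≤ (s ∸ t) _ _ (s≤s⁻¹ (begin
  suc (c * p + 2 + (s ∸ t))        ≡⟨ +-suc (c * p + 2) (s ∸ t) ⟨
  c * p + 2 + c                    ≡⟨ +-assoc (c * p) 2 c ⟩
  c * p + (2 + c)                  ≡⟨ +-comm (c * p) (2 + c) ⟩
  2 + (c + c * p)                  ≡⟨ cong (2 +_) (*-suc c p) ⟨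
  2 + c * suc p                    ≡⟨ cong (2 +_) (*-comm c (suc p)) ⟩
  2 + suc p * c                    ≡⟨ cong (λ q → 2 + q * c) eq ⟨
  2 + quot s t * c                 ≤⟨ +-monoʳ-≤ 2 (m/n*n≤m (2 * s ∸ t ∸ 1) c) ⟩
  2 + (2 * s ∸ t ∸ 1)              ≡⟨ cong suc (m+[n∸m]≡n (m<n⇒0<n∸m t<2s)) ⟩
  suc (2 * s ∸ t)                  ≡⟨ cong (λ x → suc (s + x ∸ t)) (+-identityʳ s) ⟩
  suc (s + s ∸ t)                  ≡⟨ cong suc (+-∸-assoc s (<⇒≤ t<s)) ⟩
  suc (s + (s ∸ t))                ∎))
  where
  c = suc (s ∸ t)
  t<2s : t < 2 * s
  t<2s = ≤-trans t<s (m≤m+n s _)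

theorem1p3 : (s t r n : ℕ) (1≤t : 1 ≤ t) (t<s : t < s) → 2 ≤ r →
    L s t n r ≤ (s ∸ 1) * (n C ℓ s t r 1≤t t<s) + (s ∸ 1)
theorem1p3 s t r n 1≤t t<s 2≤r
  with E , G , thin ← IsMaximum.attained (L-isMaximum {s} {t} {n} {r} (≤-trans (s≤s z≤n) t<s))
  -- `suc (s ∸ t)` is the least `j` with `s < j + t`: apart from that many edges without own vertex,
  -- only `t - 1` of the `s` are left.
  = thin-size (pred q) (ℓ s t r 1≤t t<s) (suc (s ∸ t)) G thin (≤-trans (s≤s 1≤t) t<s)
      (⌈n/d⌉≤n r q)
      (subst (λ x → r ≤ x * ℓ s t r 1≤t t<s) (sym (suc-pred q)) (n≤⌈n/d⌉*d r q))
      (quot-bound (pred q) t<s (sym (suc-pred q)))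
      (≤-reflexive (sym (cong suc (m∸n+n≡m (<⇒≤ t<s)))))
  where
  q = quot s t
  instance
    q≢0 : NonZero q
    q≢0 = quot-nonZero 1≤t t<s
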